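{- For all integers $n \geq 0$ and $l$ with $0 \leq l \leq n$, one has \[\sum_{i=0}^{l} \binom{n-i}{i}\binom{l+i}{2i+1}=\sum_{i=0}^{l} \binom{n-i}{i-1}\binom{l+i}{2i}.\]
   Context: Convention for binomial coefficients: for integers $m \geq 0$ and $j$, $\binom{m}{j}$ is the usual binomial coefficient if $0 \leq j \leq m$, and $\binom{m}{j}=0$ if $j<0$ or $j>m$. (Under the hypothesis $l \leq n$, all upper entries occurring in the identity are non-negative.) -}

module Defs where

open import Data.Integer.Base using (ℤ; +_; -[1+_])
open import Data.List.Base using (map; upTo)
open import Data.Nat.Base using (ℕ; suc)
open import Data.Nat.Combinatorics using (_C_)
open import Data.Nat.ListAction using (sum)

infixl 6.5 _choose_

-- The lower entry is an integer: the coefficient vanishes for a negative one.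
-- The library's m C k is already 0 when k > m.
_choose_ : ℕ → ℤ → ℕ
m choose (+ k)    = m C k
m choose -[1+ _ ] = 0

-- Both endpoints 0 and l are included.
∑≤ : ℕ → (ℕ → ℕ) → ℕ
∑≤ l f = sum (map f (upTo (suc l)))

infix 5 ∑≤
syntax ∑≤ l (λ i → t) = ∑[ i ≤ l ] t

{-# OPTIONS --safe #-}
-- Write A(n,l) and B(n,l) for the two sides. By Pascal's rule, for l ≤ n, both
--   A(n+1,l+1) = P + B(n,l) + A(n+1,l)   and   B(n+1,l+1) = P + A(n,l) + B(n+1,l)
-- hold with P = ∑ C(n-i,i) C(l+i,2i), so the identity follows by induction on l.
module Submission where

open import Algebra.Properties.CommutativeSemigroup using (interchange)
open import Data.Integer.Base using (+_; -[1+_]; _-_)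
open import Data.List.Properties using (map-upTo)
open import Data.Nat.Base using (ℕ; zero; suc; _+_; _*_; _∸_; _≤_; z≤n; s≤s)
open import Data.Nat.Combinatorics using (_C_; nCk+nC[k+1]≡[n+1]C[k+1]; k>n⇒nCk≡0)
open import Data.Nat.ListAction using (sum)
open import Data.Nat.Properties
  using (+-assoc; +-comm; +-commutativeSemigroup; +-identityʳ; +-suc; *-zeroʳ; *-distribˡ-+; *-distribʳ-+;
         +-∸-assoc; ≤-reflexive; ≤-trans; m≤n⇒m≤1+n)
open import Data.Nat.Tactic.RingSolver using (solve-∀)
open import Relation.Binary.PropositionalEquality
  using (_≡_; refl; sym; trans; cong; cong₂; module ≡-Reasoning)
open import Defs

open ≡-Reasoning

-- Pascal's rule survives at `k = 0` because the lower entry `-1` contributes 0. This makes the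
-- boundary index `i = 0` of `B-term` an ordinary case.
choose-pascal : ∀ m k → suc m choose k ≡ m choose (k - + 1) + m choose k
choose-pascal m (+ zero)  = refl
choose-pascal m (+ suc k) = sym (nCk+nC[k+1]≡[n+1]C[k+1] m k)
choose-pascal m -[1+ k ]  = refl

∑-head : ∀ l f → ∑≤ (suc l) f ≡ f 0 + ∑≤ l (λ i → f (suc i))
∑-head l f = trans (cong sum (map-upTo f (suc (suc l))))
                   (cong (λ xs → f 0 + sum xs) (sym (map-upTo (λ i → f (suc i)) (suc l))))

∑-last : ∀ l f → ∑≤ (suc l) f ≡ ∑≤ l f + f (suc l)
∑-last zero    f = regroup (f 0) (f 1)
  where
  regroup : ∀ a b → a + (b + 0) ≡ a + 0 + b
  regroup = solve-∀
∑-last (suc l) f = begin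
  ∑≤ (suc (suc l)) f                               ≡⟨ ∑-head (suc l) f ⟩
  f 0 + ∑≤ (suc l) (λ i → f (suc i))               ≡⟨ cong (_+_ (f 0)) (∑-last l (λ i → f (suc i))) ⟩
  f 0 + (∑≤ l (λ i → f (suc i)) + f (suc (suc l))) ≡⟨ +-assoc (f 0) _ _ ⟨
  f 0 + ∑≤ l (λ i → f (suc i)) + f (suc (suc l))   ≡⟨ cong (_+ f (suc (suc l))) (∑-head l f) ⟨
  ∑≤ (suc l) f + f (suc (suc l))                   ∎

∑-last-zero : ∀ l f → f (suc l) ≡ 0 → ∑≤ (suc l) f ≡ ∑≤ l f
∑-last-zero l f z = trans (∑-last l f) (trans (cong (_+_ (∑≤ l f)) z) (+-identityʳ _))

∑-cong : ∀ l {f g} → (∀ {i} → i ≤ l → f i ≡ g i) → ∑≤ l f ≡ ∑≤ l g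
∑-cong zero            eq = cong (_+ 0) (eq z≤n)
∑-cong (suc l) {f} {g} eq = begin
  ∑≤ (suc l) f                 ≡⟨ ∑-head l f ⟩
  f 0 + ∑≤ l (λ i → f (suc i)) ≡⟨ cong₂ _+_ (eq z≤n) (∑-cong l (λ i≤l → eq (s≤s i≤l))) ⟩
  g 0 + ∑≤ l (λ i → g (suc i)) ≡⟨ ∑-head l g ⟨
  ∑≤ (suc l) g                 ∎

∑-distrib-+ : ∀ l f g → ∑[ i ≤ l ] (f i + g i) ≡ ∑≤ l f + ∑≤ l g
∑-distrib-+ zero    f g = interchange +-commutativeSemigroup (f 0) (g 0) 0 0
∑-distrib-+ (suc l) f g = begin
  ∑[ i ≤ suc l ] (f i + g i)                   ≡⟨ ∑-last l (λ i → f i + g i) ⟩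
  (∑[ i ≤ l ] (f i + g i)) + (f (suc l) + g (suc l))
    ≡⟨ cong (_+ (f (suc l) + g (suc l))) (∑-distrib-+ l f g) ⟩
  (∑≤ l f + ∑≤ l g) + (f (suc l) + g (suc l))  ≡⟨ interchange +-commutativeSemigroup (∑≤ l f) _ _ _ ⟩
  (∑≤ l f + f (suc l)) + (∑≤ l g + g (suc l))  ≡⟨ cong₂ _+_ (∑-last l f) (∑-last l g) ⟨
  ∑≤ (suc l) f + ∑≤ (suc l) g                  ∎

∑-cong-+ : ∀ l {f} g h → (∀ {i} → i ≤ l → f i ≡ g i + h i) → ∑≤ l f ≡ ∑≤ l g + ∑≤ l h
∑-cong-+ l g h eq = trans (∑-cong l eq) (∑-distrib-+ l g h)

A-term B-term P-term : (n l i : ℕ) → ℕ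
A-term n l i = ((n ∸ i) choose (+ i)) * ((l + i) choose (+ (2 * i + 1)))
B-term n l i = ((n ∸ i) choose (+ i - + 1)) * ((l + i) choose (+ (2 * i)))
P-term n l i = ((n ∸ i) choose (+ i)) * ((l + i) choose (+ (2 * i)))

A B P : (n l : ℕ) → ℕ
A n l = ∑≤ l (A-term n l)
B n l = ∑≤ l (B-term n l)
P n l = ∑≤ l (P-term n l)

C-pascal-odd : ∀ m i → suc m C (2 * i + 1) ≡ m C (2 * i) + m C (2 * i + 1)
C-pascal-odd m i rewrite +-comm (2 * i) 1 = sym (nCk+nC[k+1]≡[n+1]C[k+1] m (2 * i))

-- The second factor is C(2l+2, 2l+3), whose lower entry exceeds the upper by one.
A-last : ∀ n l → A-term n (suc l) (suc l) ≡ 0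
A-last n l = trans (cong (c *_) (k>n⇒nCk≡0 (≤-reflexive (lem l)))) (*-zeroʳ c)
  where
  c = (n ∸ suc l) C suc l
  lem : ∀ l → suc (suc l + suc l) ≡ 2 * suc l + 1
  lem = solve-∀

-- Here the second factor is C(2l+1, 2l+2) = 0, so the range of `B n l` may be extended by one
-- index.
B-last : ∀ n l → B-term n l (suc l) ≡ 0
B-last n l = trans (cong (c *_) (k>n⇒nCk≡0 (≤-reflexive (lem l)))) (*-zeroʳ c)
  where
  c = (n ∸ suc l) C l
  lem : ∀ l → suc (l + suc l) ≡ 2 * suc l
  lem = solve-∀

-- Pascal's rule on the second factor alone. As `n` stays fixed, it serves both recurrences:
-- `A-step` takes it at `suc n`, `B-step` at `n`.
A-term-split : ∀ n l i → A-term n (suc l) i ≡ P-term n l i + A-term n l i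
A-term-split n l i = trans (cong (c *_) (C-pascal-odd (l + i) i)) (*-distribˡ-+ c _ _)
  where c = (n ∸ i) C i

-- Pascal's rule on the first factor. The bound `i ≤ n` makes `suc n ∸ i` equal to `suc (n ∸ i)`;
-- truncated subtraction breaks this at `i = suc n`.
P-term-split : ∀ n l {i} → i ≤ n → P-term (suc n) l i ≡ P-term n l i + B-term n l i
P-term-split n l {i} i≤n = begin
  ((suc n ∸ i) C i) * d                      ≡⟨ cong (λ m → (m C i) * d) (+-∸-assoc 1 i≤n) ⟩
  (suc (n ∸ i) C i) * d                      ≡⟨ cong (_* d) (choose-pascal (n ∸ i) (+ i)) ⟩
  ((n ∸ i) choose (+ i - + 1) + (n ∸ i) C i) * d ≡⟨ *-distribʳ-+ d ((n ∸ i) choose (+ i - + 1)) _ ⟩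
  B-term n l i + P-term n l i                ≡⟨ +-comm (B-term n l i) _ ⟩
  P-term n l i + B-term n l i                ∎
  where d = (l + i) C (2 * i)

-- Moving to index `suc i` turns the first factor into C(n-i, i), the one in `A-term n`. Pascal's
-- rule on the second factor then yields the lower entries 2i+1 and 2i+2.
B-term-split : ∀ n l i →
  B-term (suc n) (suc l) (suc i) ≡ A-term n (suc l) i + B-term (suc n) l (suc i)
B-term-split n l i = begin
  c * (suc (l + suc i) C (2 * suc i))
    ≡⟨ cong (λ k → c * (suc (l + suc i) C k)) (2*suc i) ⟩
  c * (suc (l + suc i) C suc (2 * i + 1))
    ≡⟨ cong (c *_) (nCk+nC[k+1]≡[n+1]C[k+1] (l + suc i) (2 * i + 1)) ⟨
  c * ((l + suc i) C (2 * i + 1) + (l + suc i) C suc (2 * i + 1))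
    -- Only the first upper entry is rewritten, to match `suc l + i` in `A-term`; the other keeps
    -- the form `l + suc i` required by `B-term`.
    ≡⟨ cong₂ (λ m k → c * (m C (2 * i + 1) + (l + suc i) C k)) (+-suc l i) (sym (2*suc i)) ⟩
  c * (suc (l + i) C (2 * i + 1) + (l + suc i) C (2 * suc i))
    ≡⟨ *-distribˡ-+ c _ _ ⟩
  A-term n (suc l) i + B-term (suc n) l (suc i) ∎
  where
  c = (n ∸ i) C i
  2*suc : ∀ i → 2 * suc i ≡ suc (2 * i + 1)
  2*suc = solve-∀

A-step : ∀ n l → l ≤ n → A (suc n) (suc l) ≡ P n l + B n l + A (suc n) l
A-step n l l≤n = begin
  A (suc n) (suc l)
    ≡⟨ ∑-last-zero l (A-term (suc n) (suc l)) (A-last (suc n) l) ⟩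
  ∑≤ l (A-term (suc n) (suc l))
    ≡⟨ ∑-cong-+ l (P-term (suc n) l) (A-term (suc n) l) (λ {i} _ → A-term-split (suc n) l i) ⟩
  P (suc n) l + A (suc n) l
    -- `P` is still at `suc n`; a second use of Pascal's rule, now on the first factor, lowers it to
    -- `n` and produces `B n l`.
    ≡⟨ cong (_+ A (suc n) l)
         (∑-cong-+ l (P-term n l) (B-term n l) (λ i≤l → P-term-split n l (≤-trans i≤l l≤n))) ⟩
  P n l + B n l + A (suc n) l ∎

B-step : ∀ n l → B (suc n) (suc l) ≡ P n l + A n l + B (suc n) l
B-step n l = begin
  B (suc n) (suc l)
    -- The term at `i = 0` contains C(n+1, -1) and reduces to 0, leaving the shifted sum.
    ≡⟨ ∑-head l (B-term (suc n) (suc l)) ⟩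
  ∑[ i ≤ l ] B-term (suc n) (suc l) (suc i)
    ≡⟨ ∑-cong-+ l (A-term n (suc l)) (λ i → B-term (suc n) l (suc i)) (λ {i} _ → B-term-split n l i) ⟩
  ∑≤ l (A-term n (suc l)) + (∑[ i ≤ l ] B-term (suc n) l (suc i))
    ≡⟨ cong₂ _+_
         (∑-cong-+ l (P-term n l) (A-term n l) (λ {i} _ → A-term-split n l i))
         -- The shift is undone by restoring the zero term at `i = 0`; the sum then runs to `suc l`,
         -- and `B-last` removes its top term.
         (sym (∑-head l (B-term (suc n) l))) ⟩
  P n l + A n l + ∑≤ (suc l) (B-term (suc n) l)
    ≡⟨ cong (_+_ (P n l + A n l)) (∑-last-zero l (B-term (suc n) l) (B-last (suc n) l)) ⟩
  P n l + A n l + B (suc n) l ∎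

mainTheorem1 : ∀ (n l : ℕ) → l ≤ n →
    ∑[ i ≤ l ] (((n ∸ i) choose (+ i)) * ((l + i) choose (+ (2 * i + 1))))
    ≡ ∑[ i ≤ l ] (((n ∸ i) choose (+ i - + 1)) * ((l + i) choose (+ (2 * i))))
-- Each side is a single vanishing term: C(0, 1) = 0 on the left, C(n, -1) = 0 on the right.
mainTheorem1 n       zero    z≤n       = cong (_+ 0) (*-zeroʳ (n C 0))
mainTheorem1 (suc n) (suc l) (s≤s l≤n) = begin
  A (suc n) (suc l)           ≡⟨ A-step n l l≤n ⟩
  P n l + B n l + A (suc n) l
    -- The induction hypothesis at `n` is read from right to left, the one at `suc n` from left to
    -- right: the two recurrences exchange the roles of `A` and `B`.
    ≡⟨ cong₂ (λ b a → P n l + b + a) (sym (mainTheorem1 n l l≤n)) (mainTheorem1 (suc n) l (m≤n⇒m≤1+n l≤n)) ⟩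
  P n l + A n l + B (suc n) l ≡⟨ B-step n l ⟨
  B (suc n) (suc l)           ∎
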